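{- As Laurent series in $z$, $$\sum_{n\ge0}\binom{2n+2}{n}z^n=\frac{13}{z^2}+3\left(-\frac{z+1}{z^2}+3\frac{1-z-z^2}{z^2(1-z)}\right)\Psi(-z)+\left(4+\frac6z-\frac4{z^2}\right)\Psi^3(-z)+3\left(4z+2-\frac1z-\frac5{z^2}\right)\Psi^5(-z)\quad\text{modulo }27.$$
   Context: $\Psi(z)=\prod_{j\ge0}(1+z^{3^j})$, so $\Psi(-z)=\prod_{j\ge0}(1-z^{3^j})$. Rational functions are expanded as Laurent series in $z$; "modulo $27$" means all coefficients of the difference are divisible by $27$. -}

module Defs where

open import Data.Bool.Base using (if_then_else_)
open import Data.Fin.Base using (toℕ)
open import Data.Integer.Base as ℤ using (ℤ; +_; -[1+_]; 0ℤ; 1ℤ; -1ℤ)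
open import Data.Integer.Divisibility using (_∣_)
import Data.Integer.Properties as ℤₚ
open import Data.Nat.Base as ℕ using (ℕ; zero; suc; _∸_; _≤_; _<_; z≤n; s≤s)
open import Data.Nat.Properties as ℕₚ using (_≟_)
open import Relation.Binary.PropositionalEquality
  using (_≡_; refl; sym; trans; cong; cong₂)
open import Relation.Nullary.Decidable using (does; dec-false)

open import Algebra.Properties.CommutativeMonoid.Sum ℤₚ.+-0-commutativeMonoid
  using (sum⁺-syntax; sum-cong-≗; sum-replicate-zero)

------------------------------------------------------------------------
-- Formal power series over ℤ

PowerSeries : Set
PowerSeries = ℕ → ℤ

infixl 6 _+ᵖ_ _-ᵖ_
infixl 7 _*ᵖ_

_+ᵖ_ _-ᵖ_ _*ᵖ_ : PowerSeries → PowerSeries → PowerSeries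
(a +ᵖ b) n = a n ℤ.+ b n
(a -ᵖ b) n = a n ℤ.- b n
(a *ᵖ b) n = ∑[ k ≤ n ] (a (toℕ k) ℤ.* b (n ∸ toℕ k))

zᵖ^_ : ℕ → PowerSeries
(zᵖ^ k) n = if does (n ≟ k) then 1ℤ else 0ℤ

1ᵖ : PowerSeries
1ᵖ = zᵖ^ 0

-- shift k a  is  z^k · a(z).
shift : ℕ → PowerSeries → PowerSeries
shift zero    a n       = a n
shift (suc k) a zero    = 0ℤ
shift (suc k) a (suc n) = shift k a n

-- a ⟨-z⟩  is  a(-z).
_⟨-z⟩ : PowerSeries → PowerSeries
(a ⟨-z⟩) n = (-1ℤ ℤ.^ n) ℤ.* a n

∏ : ℕ → (ℕ → PowerSeries) → PowerSeries
∏ zero    f = 1ᵖ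
∏ (suc m) f = f m *ᵖ ∏ m f

-- The infinite product f 0 · f 1 · f 2 ⋯, for families in which f j agrees
-- with 1 up to degree j: the coefficient of z^n is then the same in all partial
-- products with at least n factors (∏∞-limit).
∏∞ : (ℕ → PowerSeries) → PowerSeries
∏∞ f n = ∏ n f n

Ψ : PowerSeries
Ψ = ∏∞ λ j → 1ᵖ +ᵖ zᵖ^ (3 ℕ.^ j)

------------------------------------------------------------------------
-- Formal Laurent series over ℤ

-- laurent p a  is  z^(-p) · (a 0 + a 1 z + a 2 z² + ⋯). Representations are not
-- unique (a 0 may vanish), so Laurent series are compared through coeff.
record Laurent : Set where
  constructor laurent
  field
    pole  : ℕ
    coefs : PowerSeries

open Laurent public

coeff : Laurent → ℤ → ℤ
coeff f i = at (i ℤ.+ + pole f)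
  where
  at : ℤ → ℤ
  at (+ n)    = coefs f n
  at -[1+ _ ] = 0ℤ

infixl 6 _+_ _-_
infixl 7 _*_ _/z^_
infix  8 -_
infixr 8 _^_

_+_ _-_ _*_ : Laurent → Laurent → Laurent
laurent p a + laurent q b = laurent (p ℕ.+ q) (shift q a +ᵖ shift p b)
laurent p a - laurent q b = laurent (p ℕ.+ q) (shift q a -ᵖ shift p b)
laurent p a * laurent q b = laurent (p ℕ.+ q) (a *ᵖ b)

-_ : Laurent → Laurent
- laurent p a = laurent p λ n → ℤ.- a n

series : PowerSeries → Laurent
series = laurent 0

infix 9 #_

-- The constant series c.
#_ : ℤ → Laurent
# c = series λ n → c ℤ.* 1ᵖ n

_^_ : Laurent → ℕ → Laurent
f ^ zero  = # 1ℤ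
f ^ suc n = f * f ^ n

z : Laurent
z = series (zᵖ^ 1)

_/z^_ : Laurent → ℕ → Laurent
laurent p a /z^ k = laurent (p ℕ.+ k) a

-- The expansion of 1/(1 - z); see 1/[1-z]-inverse.
1/[1-z] : Laurent
1/[1-z] = series λ _ → 1ℤ

infix 4 _≈_[mod_]

_≈_[mod_] : Laurent → Laurent → ℕ → Set
f ≈ g [mod m ] = ∀ (i : ℤ) → + m ∣ coeff (f - g) i

------------------------------------------------------------------------
-- The definitions of ∏∞, Ψ and 1/[1-z] mean what they should

*ᵖ-unit-upto : ∀ (a b : PowerSeries) n → (∀ k → k ≤ n → a k ≡ 1ᵖ k) →
               (a *ᵖ b) n ≡ b n
*ᵖ-unit-upto a b n a≡1 = trans
  (cong₂ ℤ._+_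
    (trans (cong (ℤ._* b n) (a≡1 0 z≤n)) (ℤₚ.*-identityˡ (b n)))
    (trans (sum-cong-≗ λ k → trans
             (cong (ℤ._* b (n ∸ suc (toℕ k))) (a≡1 (suc (toℕ k)) (toℕ<n k)))
             (ℤₚ.*-zeroˡ (b (n ∸ suc (toℕ k)))))
           (sum-replicate-zero n)))
  (ℤₚ.+-identityʳ (b n))
  where open import Data.Fin.Properties using (toℕ<n)

∏∞-limit : ∀ f → (∀ j k → k ≤ j → f j k ≡ 1ᵖ k) →
           ∀ m n → n ≤ m → ∏ m f n ≡ ∏∞ f n
∏∞-limit f f≡1 m n n≤m = trans (cong (λ x → ∏ x f n) (sym (ℕₚ.m∸n+n≡m n≤m)))
                               (go (m ∸ n))
  where
  go : ∀ d → ∏ (d ℕ.+ n) f n ≡ ∏ n f n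
  go zero    = refl
  go (suc d) = trans
    (*ᵖ-unit-upto (f (d ℕ.+ n)) (∏ (d ℕ.+ n) f) n
      (λ k k≤n → f≡1 (d ℕ.+ n) k (ℕₚ.≤-trans k≤n (ℕₚ.m≤n+m n d))))
    (go d)

Ψ-factor : ∀ j k → k ≤ j → (1ᵖ +ᵖ zᵖ^ (3 ℕ.^ j)) k ≡ 1ᵖ k
Ψ-factor j k k≤j = trans
  (cong (λ b → 1ᵖ k ℤ.+ (if b then 1ℤ else 0ℤ))
        (dec-false (k ≟ 3 ℕ.^ j) (ℕₚ.<⇒≢ (ℕₚ.≤-<-trans k≤j (j<3^j j)))))
  (ℤₚ.+-identityʳ (1ᵖ k))
  where
  j<3^j : ∀ j → j < 3 ℕ.^ j
  j<3^j zero    = s≤s z≤n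
  j<3^j (suc j) = ℕₚ.<-≤-trans (s≤s (j<3^j j))
    (ℕₚ.+-mono-≤ (ℕₚ.m^n>0 3 j) (ℕₚ.m≤m+n (3 ℕ.^ j) _))

Ψ-limit : ∀ m n → n ≤ m → ∏ m (λ j → 1ᵖ +ᵖ zᵖ^ (3 ℕ.^ j)) n ≡ Ψ n
Ψ-limit = ∏∞-limit (λ j → 1ᵖ +ᵖ zᵖ^ (3 ℕ.^ j)) Ψ-factor

1/[1-z]-inverse : ∀ i → coeff ((# 1ℤ - z) * 1/[1-z]) i ≡ coeff (# 1ℤ) i
1/[1-z]-inverse i with i ℤ.+ 0ℤ
... | -[1+ _ ]    = refl
... | + zero      = refl
... | + suc zero  = refl
... | + suc (suc n) = cong (λ x → 1ℤ ℤ.+ (-1ℤ ℤ.+ x)) (sum-replicate-zero (suc n))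

{-# OPTIONS --safe #-}

-- Let P = Ψ(-z), let S be the generating function of the central binomial
-- coefficients, let L be that of the theorem, and let R be z² times its
-- right-hand side.
--
-- * Since (1 + x)³ ≡ 1 + x³ modulo 3, the products Ψₘ of the first m factors
--   satisfy Ψₘ² (1 + z) ≡ 1 + z^(3^m) modulo 3, by induction on m. In the limit,
--   P² (1 - z) = 1 + 3F for some integral series F.
-- * Pascal's rule gives 1 + 2z²L = (1 - 2z) S, and S² (1 - 4z) = 1 because
--   z d/dz annihilates the left-hand side.
-- * 1 + 2R is congruent modulo 27 to P times an even polynomial in P. Replacing
--   P² (1 - z) by 1 + 3F in (1 + 2R)² (1 - 4z) (1 - z)⁵ yields
--   (1 - 2z)² (1 - z)⁵ modulo 27: all terms containing F cancel.
-- * Hence X = 1 + 2z²L and Y = 1 + 2R have the same square modulo 27. The factor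
--   X + Y of X² - Y² has constant term 2, so it can be cancelled, and
--   2 (z²L - R) = X - Y ≡ 0.
module Submission where

open import Defs hiding (_+_; _-_; _*_; -_; _^_; _/z^_; z; #_)
open import Data.Integer.Base as ℤ using (ℤ; +_; 0ℤ; 1ℤ; -1ℤ)
open import Data.Nat.Base as ℕ using (ℕ; zero; suc; _∸_; _≤_; z≤n; s≤s)
  renaming (_+_ to _+ℕ_; _*_ to _*ℕ_)
open import Data.Nat.Combinatorics using (_C_; nC1≡n; nCk≡nC[n∸k]; nCk+nC[k+1]≡[n+1]C[k+1])
open import Algebra.Bundles using (CommutativeRing)
open import Algebra.Properties.CommutativeMonoid.Sum using (sum-cong-≗)
open import Algebra.Solver.Ring.AlmostCommutativeRing
  using (fromCommutativeRing; _-Raw-AlmostCommutative⟶_)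
open import Data.Fin.Base using (zero; suc; toℕ)
open import Data.Fin.Properties using (toℕ<n)
import Data.Integer.Divisibility as Unsigned
open import Data.Integer.Divisibility.Signed
open import Data.Integer.Coprimality using (Coprime; coprime?; coprime-divisor)
import Data.Integer.Properties as ℤₚ
import Data.Integer.Solver as ℤSolver
import Data.Nat.Properties as ℕₚ
import Data.Nat.Solver as ℕSolver
import Data.Maybe.Base as Maybe
open import Data.Product.Base using (_,_)
open import Data.Vec.Base using (Vec; []; _∷_)
open import Data.Vec.Relation.Binary.Pointwise.Inductive as Pointwise using (Pointwise; []; _∷_)
open import Data.Unit.Base using (tt)
import Data.Nat.Divisibility as ℕ using (divides)
open import Data.Sum.Base using (inj₁; inj₂)
open import Function.Base using (_∘_)
open import Level using (0ℓ)
open import Relation.Binary.PropositionalEquality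
  using (_≡_; _≗_; refl; sym; trans; cong; cong₂; subst; module ≡-Reasoning)
open import Relation.Nullary.Decidable using (dec⇒maybe; toWitness)

-- Convolution products of integer power series

module _ where

  open ℤSolver.+-*-Solver using (solve; _:+_; _:*_; _:-_; _:=_; con)

  -- The inductions below rest on `(a *ᵖ b) (suc n)` computing to
  -- `a 0 ℤ.* b (suc n) ℤ.+ (tail a *ᵖ b) n`: the left factor loses its head, the right one stays.
  tail : PowerSeries → PowerSeries
  tail a n = a (suc n)

  0ᵖ : PowerSeries
  0ᵖ _ = 0ℤ

  -ᵖ_ : PowerSeries → PowerSeries
  (-ᵖ a) n = ℤ.- a n

  const : ℤ → PowerSeries
  const c n = c ℤ.* 1ᵖ n

  -- Only coefficients up to `n` enter the convolution. The bounded form lets `Ψ` be exchanged for a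
  -- partial product that is known to agree with it only up to a given degree.
  *ᵖ-cong-upto : ∀ {a a′ b b′} n → (∀ k → k ≤ n → a k ≡ a′ k) →
                 (∀ k → k ≤ n → b k ≡ b′ k) → (a *ᵖ b) n ≡ (a′ *ᵖ b′) n
  *ᵖ-cong-upto n a≡a′ b≡b′ = sum-cong-≗ ℤₚ.+-0-commutativeMonoid {n = suc n} λ k →
    cong₂ ℤ._*_ (a≡a′ (toℕ k) (ℕₚ.<⇒≤pred (toℕ<n k)))
                (b≡b′ (n ∸ toℕ k) (ℕₚ.m∸n≤m n (toℕ k)))

  *ᵖ-congʳ : ∀ {a a′} b → a ≗ a′ → a *ᵖ b ≗ a′ *ᵖ b
  *ᵖ-congʳ b a≗a′ n = *ᵖ-cong-upto {b = b} {b′ = b} n (λ k _ → a≗a′ k) (λ _ _ → refl)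

  *ᵖ-congˡ : ∀ a {b b′} → b ≗ b′ → a *ᵖ b ≗ a *ᵖ b′
  *ᵖ-congˡ a b≗b′ n = *ᵖ-cong-upto {a} {a} n (λ _ _ → refl) (λ k _ → b≗b′ k)

  *ᵖ-zeroˡ : ∀ a → 0ᵖ *ᵖ a ≗ 0ᵖ
  *ᵖ-zeroˡ a zero    = refl
  *ᵖ-zeroˡ a (suc n) = trans (ℤₚ.+-identityˡ _) (*ᵖ-zeroˡ a n)

  *ᵖ-identityˡ : ∀ a → 1ᵖ *ᵖ a ≗ a
  *ᵖ-identityˡ a zero    = trans (ℤₚ.+-identityʳ _) (ℤₚ.*-identityˡ (a 0))
  *ᵖ-identityˡ a (suc n) = trans
    (cong₂ ℤ._+_ (ℤₚ.*-identityˡ (a (suc n))) (*ᵖ-zeroˡ a n))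
    (ℤₚ.+-identityʳ _)

  *ᵖ-scaleˡ : ∀ c a b → (λ n → c ℤ.* a n) *ᵖ b ≗ λ n → c ℤ.* (a *ᵖ b) n
  *ᵖ-scaleˡ c a b zero =
    solve 3 (λ c x y → c :* x :* y :+ con 0ℤ := c :* (x :* y :+ con 0ℤ)) refl c (a 0) (b 0)
  *ᵖ-scaleˡ c a b (suc n) = trans
    (cong (λ t → c ℤ.* a 0 ℤ.* b (suc n) ℤ.+ t) (*ᵖ-scaleˡ c (tail a) b n))
    (solve 4 (λ c x y t → c :* x :* y :+ c :* t := c :* (x :* y :+ t)) refl
       c (a 0) (b (suc n)) ((tail a *ᵖ b) n))

  *ᵖ-distribʳ : ∀ c a b → (a +ᵖ b) *ᵖ c ≗ (a *ᵖ c) +ᵖ (b *ᵖ c)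
  *ᵖ-distribʳ c a b zero =
    solve 3 (λ x y z → (x :+ y) :* z :+ con 0ℤ := x :* z :+ con 0ℤ :+ (y :* z :+ con 0ℤ)) refl
      (a 0) (b 0) (c 0)
  *ᵖ-distribʳ c a b (suc n) = trans
    (cong (λ t → (a 0 ℤ.+ b 0) ℤ.* c (suc n) ℤ.+ t) (*ᵖ-distribʳ c (tail a) (tail b) n))
    (solve 5 (λ x y z s t → (x :+ y) :* z :+ (s :+ t) := x :* z :+ s :+ (y :* z :+ t)) refl
      (a 0) (b 0) (c (suc n)) ((tail a *ᵖ c) n) ((tail b *ᵖ c) n))

  *ᵖ-assoc : ∀ a b c → (a *ᵖ b) *ᵖ c ≗ a *ᵖ (b *ᵖ c)
  *ᵖ-assoc a b c zero =
    solve 3 (λ x y z → (x :* y :+ con 0ℤ) :* z :+ con 0ℤ := x :* (y :* z :+ con 0ℤ) :+ con 0ℤ)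
      refl (a 0) (b 0) (c 0)
  *ᵖ-assoc a b c (suc n) = begin
    ((a *ᵖ b) *ᵖ c) (suc n)
      ≡⟨ cong (λ t → (a *ᵖ b) 0 ℤ.* c (suc n) ℤ.+ t)
           (*ᵖ-distribʳ c (λ k → a 0 ℤ.* tail b k) (tail a *ᵖ b) n) ⟩
    _
      ≡⟨ cong₂ (λ s t → (a *ᵖ b) 0 ℤ.* c (suc n) ℤ.+ (s ℤ.+ t))
           (*ᵖ-scaleˡ (a 0) (tail b) c n) (*ᵖ-assoc (tail a) b c n) ⟩
    _
      ≡⟨ solve 5 (λ x y z s t →
             (x :* y :+ con 0ℤ) :* z :+ (x :* s :+ t) := x :* (y :* z :+ s) :+ t) refl
           (a 0) (b 0) (c (suc n)) ((tail b *ᵖ c) n) ((tail a *ᵖ (b *ᵖ c)) n) ⟩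
    (a *ᵖ (b *ᵖ c)) (suc n) ∎
    where open ≡-Reasoning

  -- The counterpart of the definitional recursion, peeling off the last summand; matching the two
  -- gives commutativity.
  *ᵖ-sucʳ : ∀ a b n → (a *ᵖ b) (suc n) ≡ (a *ᵖ tail b) n ℤ.+ a (suc n) ℤ.* b 0
  *ᵖ-sucʳ a b zero =
    solve 4 (λ x y x′ y′ → x :* y′ :+ (x′ :* y :+ con 0ℤ) := x :* y′ :+ con 0ℤ :+ x′ :* y) refl
      (a 0) (b 0) (a 1) (b 1)
  *ᵖ-sucʳ a b (suc n) = trans
    (cong (λ t → a 0 ℤ.* b (suc (suc n)) ℤ.+ t) (*ᵖ-sucʳ (tail a) b n))
    (sym (ℤₚ.+-assoc (a 0 ℤ.* b (suc (suc n))) _ _))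

  *ᵖ-comm : ∀ a b → a *ᵖ b ≗ b *ᵖ a
  *ᵖ-comm a b zero    = cong (λ t → t ℤ.+ 0ℤ) (ℤₚ.*-comm (a 0) (b 0))
  *ᵖ-comm a b (suc n) = trans (*ᵖ-sucʳ a b n) (trans
    (cong₂ ℤ._+_ (*ᵖ-comm a (tail b) n) (ℤₚ.*-comm (a (suc n)) (b 0)))
    (ℤₚ.+-comm ((tail b *ᵖ a) n) (b 0 ℤ.* a (suc n))))

  const-* : ∀ c a → const c *ᵖ a ≗ λ n → c ℤ.* a n
  const-* c a n = trans (*ᵖ-scaleˡ c 1ᵖ a n) (cong (c ℤ.*_) (*ᵖ-identityˡ a n))

  zᵖ-*-suc : ∀ a n → (zᵖ^ 1 *ᵖ a) (suc n) ≡ a n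
  zᵖ-*-suc a n = trans (ℤₚ.+-identityˡ _) (*ᵖ-identityˡ a n)

  zᵖ-+ : ∀ k l → zᵖ^ (k +ℕ l) ≗ zᵖ^ k *ᵖ zᵖ^ l
  zᵖ-+ zero    l n       = sym (*ᵖ-identityˡ (zᵖ^ l) n)
  zᵖ-+ (suc k) l zero    = refl
  zᵖ-+ (suc k) l (suc n) = trans (zᵖ-+ k l n) (sym (ℤₚ.+-identityˡ _))

  ⟨-z⟩-* : ∀ a b → (a *ᵖ b) ⟨-z⟩ ≗ (a ⟨-z⟩) *ᵖ (b ⟨-z⟩)
  ⟨-z⟩-* a b zero =
    solve 2 (λ x y → con 1ℤ :* (x :* y :+ con 0ℤ) := con 1ℤ :* x :* (con 1ℤ :* y) :+ con 0ℤ) refl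
      (a 0) (b 0)
  ⟨-z⟩-* a b (suc n) = sym (begin
    1ℤ ℤ.* a 0 ℤ.* (-1ℤ ℤ.* s ℤ.* b (suc n)) ℤ.+ (tail (a ⟨-z⟩) *ᵖ (b ⟨-z⟩)) n
      ≡⟨ cong (λ t → 1ℤ ℤ.* a 0 ℤ.* (-1ℤ ℤ.* s ℤ.* b (suc n)) ℤ.+ t)
           (trans (*ᵖ-congʳ (b ⟨-z⟩) (λ k → ℤₚ.*-assoc -1ℤ (-1ℤ ℤ.^ k) (a (suc k))) n)
           (trans (*ᵖ-scaleˡ -1ℤ (tail a ⟨-z⟩) (b ⟨-z⟩) n)
                  (cong (-1ℤ ℤ.*_) (sym (⟨-z⟩-* (tail a) b n))))) ⟩
    1ℤ ℤ.* a 0 ℤ.* (-1ℤ ℤ.* s ℤ.* b (suc n)) ℤ.+ -1ℤ ℤ.* (s ℤ.* (tail a *ᵖ b) n)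
      ≡⟨ solve 4 (λ x s y t → con 1ℤ :* x :* (con -1ℤ :* s :* y) :+ con -1ℤ :* (s :* t)
                           := con -1ℤ :* s :* (x :* y :+ t)) refl
           (a 0) s (b (suc n)) ((tail a *ᵖ b) n) ⟩
    ((a *ᵖ b) ⟨-z⟩) (suc n) ∎)
    where
    open ≡-Reasoning
    s = -1ℤ ℤ.^ n

  -- z d/dz
  θ : PowerSeries → PowerSeries
  θ a n = + n ℤ.* a n

  θ-* : ∀ a b → θ (a *ᵖ b) ≗ (θ a *ᵖ b) +ᵖ (a *ᵖ θ b)
  θ-* a b zero =
    solve 2 (λ x y → con 0ℤ := con 0ℤ :* x :* y :+ con 0ℤ :+ (x :* (con 0ℤ :* y) :+ con 0ℤ)) refl
      (a 0) (b 0)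
  θ-* a b (suc n) = sym (begin
    0ℤ ℤ.+ (tail (θ a) *ᵖ b) n ℤ.+ (a 0 ℤ.* (+ suc n ℤ.* b (suc n)) ℤ.+ (tail a *ᵖ θ b) n)
      ≡⟨ cong (λ t → 0ℤ ℤ.+ t ℤ.+ (a 0 ℤ.* (+ suc n ℤ.* b (suc n)) ℤ.+ (tail a *ᵖ θ b) n))
           -- The tail of `θ a` is `tail a +ᵖ θ (tail a)`; the extra `tail a` accounts for the
           -- weight `suc n` exceeding `n` by one.
           (trans (*ᵖ-congʳ b (λ k → ℤₚ.suc-* (+ k) (a (suc k))) n)
                  (*ᵖ-distribʳ b (tail a) (θ (tail a)) n)) ⟩
    _
      ≡⟨ solve 6 (λ m x y s t w →
             con 0ℤ :+ (s :+ t) :+ (x :* ((con 1ℤ :+ m) :* y) :+ w)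
               := (con 1ℤ :+ m) :* (x :* y) :+ s :+ (t :+ w)) refl
           (+ n) (a 0) (b (suc n)) ((tail a *ᵖ b) n) ((θ (tail a) *ᵖ b) n) ((tail a *ᵖ θ b) n) ⟩
    _
      ≡⟨ cong (λ t → + suc n ℤ.* (a 0 ℤ.* b (suc n)) ℤ.+ (tail a *ᵖ b) n ℤ.+ t)
           (sym (θ-* (tail a) b n)) ⟩
    _
      ≡⟨ solve 3 (λ m x s → (con 1ℤ :+ m) :* x :+ s :+ m :* s := (con 1ℤ :+ m) :* (x :+ s)) refl
           (+ n) (a 0 ℤ.* b (suc n)) ((tail a *ᵖ b) n) ⟩
    θ (a *ᵖ b) (suc n) ∎)
    where open ≡-Reasoning

-- Power series modulo m as a ring with integer constants

IntegerConstants : CommutativeRing 0ℓ 0ℓ → Set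
IntegerConstants R =
  CommutativeRing.rawRing ℤₚ.+-*-commutativeRing -Raw-AlmostCommutative⟶ fromCommutativeRing R

-- Licenses a solver to compare integer coefficients modulo `m` only.
RespectsModulo : ℤ → (R : CommutativeRing 0ℓ 0ℓ) → IntegerConstants R → Set
RespectsModulo m R ι = ∀ c d → m ∣ c ℤ.- d → ⟦ c ⟧ ≈ ⟦ d ⟧
  where
  open CommutativeRing R
  open _-Raw-AlmostCommutative⟶_ ι

-- The case `m = 0` is included: congruence is then equality, so the same ring also serves exact
-- identities.
module Modulo (m : ℤ) where

  open ℤSolver.+-*-Solver using (solve; _:+_; _:*_; _:-_; :-_; _:=_; con)

  infix 4 _≡ᵐ_ _≈_

  record _≡ᵐ_ (x y : ℤ) : Set where
    constructor congruent
    field difference : m ∣ x ℤ.- y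

  record _≈_ (a b : PowerSeries) : Set where
    constructor coefficientwise
    field coefficient : ∀ n → a n ≡ᵐ b n

  open _≡ᵐ_ public
  open _≈_ public

  ≡ᵐ-reflexive : ∀ {x y} → x ≡ y → x ≡ᵐ y
  ≡ᵐ-reflexive {x} refl = congruent (divides 0ℤ (ℤₚ.+-inverseʳ x))

  ≡ᵐ-sym : ∀ {x y} → x ≡ᵐ y → y ≡ᵐ x
  ≡ᵐ-sym {x} {y} (congruent d) = congruent (subst (m ∣_)
    (solve 2 (λ x y → :- (x :- y) := y :- x) refl x y) (∣m⇒∣-m d))

  ≡ᵐ-trans : ∀ {x y z} → x ≡ᵐ y → y ≡ᵐ z → x ≡ᵐ z
  ≡ᵐ-trans {x} {y} {z} (congruent d) (congruent e) = congruent (subst (m ∣_)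
    (solve 3 (λ x y z → (x :- y) :+ (y :- z) := x :- z) refl x y z) (∣m∣n⇒∣m+n d e))

  +-≡ᵐ : ∀ {x x′ y y′} → x ≡ᵐ x′ → y ≡ᵐ y′ → x ℤ.+ y ≡ᵐ x′ ℤ.+ y′
  +-≡ᵐ {x} {x′} {y} {y′} (congruent d) (congruent e) = congruent (subst (m ∣_)
    (solve 4 (λ x x′ y y′ → (x :- x′) :+ (y :- y′) := (x :+ y) :- (x′ :+ y′)) refl x x′ y y′)
    (∣m∣n⇒∣m+n d e))

  *-≡ᵐ : ∀ {x x′ y y′} → x ≡ᵐ x′ → y ≡ᵐ y′ → x ℤ.* y ≡ᵐ x′ ℤ.* y′
  *-≡ᵐ {x} {x′} {y} {y′} (congruent d) (congruent e) = congruent (subst (m ∣_)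
    (solve 4 (λ x x′ y y′ → (x :- x′) :* y :+ x′ :* (y :- y′) := x :* y :- x′ :* y′) refl x x′ y y′)
    (∣m∣n⇒∣m+n (∣m⇒∣m*n y d) (∣n⇒∣m*n x′ e)))

  -‿≡ᵐ : ∀ {x x′} → x ≡ᵐ x′ → ℤ.- x ≡ᵐ ℤ.- x′
  -‿≡ᵐ {x} {x′} (congruent d) = congruent (subst (m ∣_)
    (solve 2 (λ x x′ → :- (x :- x′) := :- x :- :- x′) refl x x′) (∣m⇒∣-m d))

  ∣-resp-≡ᵐ : ∀ {x y} → x ≡ᵐ y → m ∣ y → m ∣ x
  ∣-resp-≡ᵐ {x} {y} (congruent d) m∣y =
    subst (m ∣_) (solve 2 (λ x y → x :- y :+ y := x) refl x y) (∣m∣n⇒∣m+n d m∣y)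

  ≗⇒≈ : ∀ {a b} → a ≗ b → a ≈ b
  ≗⇒≈ a≗b = coefficientwise λ n → ≡ᵐ-reflexive (a≗b n)

  *ᵖ-≡ᵐ : ∀ {a a′ b b′} n → (∀ k → a k ≡ᵐ a′ k) → (∀ k → b k ≡ᵐ b′ k) →
          (a *ᵖ b) n ≡ᵐ (a′ *ᵖ b′) n
  *ᵖ-≡ᵐ zero    d e = +-≡ᵐ (*-≡ᵐ (d 0) (e 0)) (≡ᵐ-reflexive refl)
  *ᵖ-≡ᵐ (suc n) d e = +-≡ᵐ (*-≡ᵐ (d 0) (e (suc n))) (*ᵖ-≡ᵐ n (d ∘ suc) e)

  ring : CommutativeRing 0ℓ 0ℓ
  ring = record
    { Carrier = PowerSeries
    ; _≈_ = _≈_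
    ; _+_ = _+ᵖ_
    ; _*_ = _*ᵖ_
    ; -_  = -ᵖ_
    ; 0#  = 0ᵖ
    ; 1#  = 1ᵖ
    ; isCommutativeRing = record
      { isRing = record
        { +-isAbelianGroup = record
          { isGroup = record
            { isMonoid = record
              { isSemigroup = record
                { isMagma = record
                  { isEquivalence = record
                    { refl  = ≗⇒≈ λ _ → refl
                    ; sym   = λ d → coefficientwise λ n → ≡ᵐ-sym (coefficient d n)
                    ; trans = λ d e → coefficientwise λ n →
                        ≡ᵐ-trans (coefficient d n) (coefficient e n)
                    }
                  ; ∙-cong = λ d e → coefficientwise λ n → +-≡ᵐ (coefficient d n) (coefficient e n)
                  }
                ; assoc = λ a b c → ≗⇒≈ λ n → ℤₚ.+-assoc (a n) (b n) (c n)
                }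
              ; identity = (λ a → ≗⇒≈ λ n → ℤₚ.+-identityˡ (a n))
                         , (λ a → ≗⇒≈ λ n → ℤₚ.+-identityʳ (a n))
              }
            ; inverse = (λ a → ≗⇒≈ λ n → ℤₚ.+-inverseˡ (a n))
                      , (λ a → ≗⇒≈ λ n → ℤₚ.+-inverseʳ (a n))
            ; ⁻¹-cong = λ d → coefficientwise λ n → -‿≡ᵐ (coefficient d n)
            }
          ; comm = λ a b → ≗⇒≈ λ n → ℤₚ.+-comm (a n) (b n)
          }
        ; *-cong = λ d e → coefficientwise λ n → *ᵖ-≡ᵐ n (coefficient d) (coefficient e)
        ; *-assoc = λ a b c → ≗⇒≈ (*ᵖ-assoc a b c)
        ; *-identity = (λ a → ≗⇒≈ (*ᵖ-identityˡ a))
                     , (λ a → ≗⇒≈ λ n → trans (*ᵖ-comm a 1ᵖ n) (*ᵖ-identityˡ a n))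
        ; distrib = (λ c a b → ≗⇒≈ λ n → trans (*ᵖ-comm c (a +ᵖ b) n) (trans (*ᵖ-distribʳ c a b n)
                      (cong₂ ℤ._+_ (*ᵖ-comm a c n) (*ᵖ-comm b c n))))
                  , (λ c a b → ≗⇒≈ (*ᵖ-distribʳ c a b))
        }
      ; *-comm = λ a b → ≗⇒≈ (*ᵖ-comm a b)
      }
    }

  constants : IntegerConstants ring
  constants = record
    { ⟦_⟧    = const
    ; +-homo = λ c d → ≗⇒≈ λ n → ℤₚ.*-distribʳ-+ (1ᵖ n) c d
    ; *-homo = λ c d → ≗⇒≈ λ n → trans (ℤₚ.*-assoc c d (1ᵖ n)) (sym (const-* c (const d) n))
    ; -‿homo = λ c → ≗⇒≈ λ n → sym (ℤₚ.neg-distribˡ-* c (1ᵖ n))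
    ; 0-homo = ≗⇒≈ λ n → ℤₚ.*-zeroˡ (1ᵖ n)
    ; 1-homo = ≗⇒≈ λ n → ℤₚ.*-identityˡ (1ᵖ n)
    }

  const-cong : RespectsModulo m ring constants
  const-cong c d m∣c-d = coefficientwise λ n →
    *-≡ᵐ {c} {d} (congruent m∣c-d) (≡ᵐ-reflexive {1ᵖ n} refl)

  quotientᵖ : ∀ {a b} → a ≈ b → PowerSeries
  quotientᵖ a≈b n = quotient (difference (coefficient a≈b n))

  -- Trades a congruence for an exact identity with an explicit correction term; modulo 3 this
  -- supplies the series F, which can then be used modulo 27.
  ≈⇒≗ : ∀ {a b} (a≈b : a ≈ b) → a ≗ b +ᵖ const m *ᵖ quotientᵖ a≈b
  ≈⇒≗ {a} {b} a≈b n = begin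
    a n                        ≡⟨ solve 2 (λ x y → x := y :+ (x :- y)) refl (a n) (b n) ⟩
    b n ℤ.+ (a n ℤ.- b n)      ≡⟨ cong (λ t → b n ℤ.+ t) (_∣_.equality (m∣a-b n)) ⟩
    b n ℤ.+ q n ℤ.* m          ≡⟨ cong (λ t → b n ℤ.+ t) (ℤₚ.*-comm (q n) m) ⟩
    b n ℤ.+ m ℤ.* q n          ≡⟨ cong (λ t → b n ℤ.+ t) (const-* m q n) ⟨
    b n ℤ.+ (const m *ᵖ q) n   ∎
    where
    open ≡-Reasoning
    q = quotientᵖ a≈b
    m∣a-b : ∀ n → m ∣ a n ℤ.- b n
    m∣a-b n = difference (coefficient a≈b n)

-- The ring is abstract here and in the modules that use the solver: over power
-- series, comparing the two sides would unfold them to convolution sums.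
module ModularSolver (m : ℤ) (R : CommutativeRing 0ℓ 0ℓ)
  (ι : IntegerConstants R) (ι-cong : RespectsModulo m R ι) where
  open import Algebra.Solver.Ring (CommutativeRing.rawRing ℤₚ.+-*-commutativeRing)
    (fromCommutativeRing R) ι
    (λ c d → Maybe.map (ι-cong c d) (dec⇒maybe (m ∣? c ℤ.- d)))
    public
  open CommutativeRing R hiding (zero)
  open _-Raw-AlmostCommutative⟶_ ι using (0-homo) renaming (⟦_⟧ to infix 9 #_)
  open import Algebra.Properties.Semiring.Exp semiring using (^-congˡ)
  open import Algebra.Properties.Group +-group using (x∙y⁻¹≈ε⇒x≈y)

  -- Known relations are substituted for the variables of a polynomial in this way, without
  -- expanding it.
  ⟦⟧-cong : ∀ {n} (p : Polynomial n) {ρ σ} → Pointwise _≈_ ρ σ → ⟦ p ⟧ ρ ≈ ⟦ p ⟧ σ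
  ⟦⟧-cong (op [+] p q) ρ≈σ = +-cong (⟦⟧-cong p ρ≈σ) (⟦⟧-cong q ρ≈σ)
  ⟦⟧-cong (op [*] p q) ρ≈σ = *-cong (⟦⟧-cong p ρ≈σ) (⟦⟧-cong q ρ≈σ)
  ⟦⟧-cong (con c)      ρ≈σ = CommutativeRing.refl R
  ⟦⟧-cong (var i)      ρ≈σ = Pointwise.lookup ρ≈σ i
  ⟦⟧-cong (p :^ n)     ρ≈σ = ^-congˡ n (⟦⟧-cong p ρ≈σ)
  ⟦⟧-cong (:- p)       ρ≈σ = -‿cong (⟦⟧-cong p ρ≈σ)

  -- Horner forms of polynomials congruent modulo m need not coincide, but that
  -- of a polynomial congruent to 0 is empty.
  x-y≈#0⇒x≈y : ∀ {x y} → x - y ≈ # 0ℤ → x ≈ y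
  x-y≈#0⇒x≈y x-y≈#0 = x∙y⁻¹≈ε⇒x≈y _ _ (CommutativeRing.trans R x-y≈#0 0-homo)

-- The square of Ψ modulo 3

module Cubes (R : CommutativeRing 0ℓ 0ℓ)
  (ι : IntegerConstants R) (ι-cong : RespectsModulo (+ 3) R ι) where
  open CommutativeRing R hiding (zero)
  open ModularSolver (+ 3) R ι ι-cong
  open _-Raw-AlmostCommutative⟶_ ι using () renaming (⟦_⟧ to infix 9 #_)

  -- The middle binomial coefficients of the cube are both 3.
  cube : ∀ x → (# 1ℤ + x) * ((# 1ℤ + x) * (# 1ℤ + x)) ≈ # 1ℤ + x * (x * x)
  cube x = x-y≈#0⇒x≈y (solve 1 (λ x →
    (con 1ℤ :+ x) :* ((con 1ℤ :+ x) :* (con 1ℤ :+ x)) :- (con 1ℤ :+ x :* (x :* x)) := con 0ℤ)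
    (CommutativeRing.refl R) x)

  -- Isolates `g * g * h`, the shape of the induction hypothesis in `∏-square`.
  square-step : ∀ f g h → (f * g) * (f * g) * h ≈ f * (f * (g * g * h))
  square-step = solve 3 (λ f g h → (f :* g) :* (f :* g) :* h := f :* (f :* (g :* g :* h)))
    (CommutativeRing.refl R)

module _ where
  open Modulo (+ 3)
  open CommutativeRing ring using (setoid; *-congˡ; *-cong; +-cong; *-identityˡ)
    renaming (refl to ≈-refl; sym to ≈-sym)
  open _-Raw-AlmostCommutative⟶_ constants using (1-homo)
  open Cubes ring constants const-cong
  open import Relation.Binary.Reasoning.Setoid setoid

  ψ-factor : ℕ → PowerSeries
  ψ-factor j = 1ᵖ +ᵖ zᵖ^ (3 ℕ.^ j)

  ψ-factor-cube : ∀ j → ψ-factor j *ᵖ (ψ-factor j *ᵖ ψ-factor j) ≈ ψ-factor (suc j)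
  ψ-factor-cube j = begin
    ψ-factor j *ᵖ (ψ-factor j *ᵖ ψ-factor j)
      ≈⟨ *-cong 1+q≈#1+q (*-cong 1+q≈#1+q 1+q≈#1+q) ⟩
    (const 1ℤ +ᵖ q) *ᵖ ((const 1ℤ +ᵖ q) *ᵖ (const 1ℤ +ᵖ q))
      ≈⟨ cube q ⟩
    const 1ℤ +ᵖ q *ᵖ (q *ᵖ q)
      ≈⟨ +-cong 1-homo (≈-sym q³) ⟩
    ψ-factor (suc j) ∎
    where
    q = zᵖ^ (3 ℕ.^ j)

    1+q≈#1+q : ψ-factor j ≈ const 1ℤ +ᵖ q
    1+q≈#1+q = +-cong (≈-sym 1-homo) ≈-refl

    q³ : zᵖ^ (3 ℕ.^ suc j) ≈ q *ᵖ (q *ᵖ q)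
    q³ = begin
      zᵖ^ (3 ℕ.^ suc j)
        -- `3 ℕ.^ suc j` unfolds to three copies of `3 ℕ.^ j` and a final summand 0, which is
        -- removed here.
        ≡⟨ cong (λ k → zᵖ^ (3 ℕ.^ j +ℕ (3 ℕ.^ j +ℕ k))) (ℕₚ.+-identityʳ (3 ℕ.^ j)) ⟩
      zᵖ^ (3 ℕ.^ j +ℕ (3 ℕ.^ j +ℕ 3 ℕ.^ j))
        ≈⟨ ≗⇒≈ (zᵖ-+ (3 ℕ.^ j) (3 ℕ.^ j +ℕ 3 ℕ.^ j)) ⟩
      q *ᵖ zᵖ^ (3 ℕ.^ j +ℕ 3 ℕ.^ j)
        ≈⟨ *-congˡ {q} (≗⇒≈ (zᵖ-+ (3 ℕ.^ j) (3 ℕ.^ j))) ⟩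
      q *ᵖ (q *ᵖ q) ∎

  -- The new factor enters squared and the induction hypothesis contributes it once more; the
  -- resulting cube is the next factor modulo 3.
  ∏-square : ∀ m → ∏ m ψ-factor *ᵖ ∏ m ψ-factor *ᵖ ψ-factor 0 ≈ ψ-factor m
  ∏-square zero    = begin
    1ᵖ *ᵖ 1ᵖ *ᵖ ψ-factor 0 ≈⟨ *-cong (*-identityˡ 1ᵖ) (≈-refl {ψ-factor 0}) ⟩
    1ᵖ *ᵖ ψ-factor 0       ≈⟨ *-identityˡ (ψ-factor 0) ⟩
    ψ-factor 0             ∎
  ∏-square (suc m) = begin
    (f *ᵖ ∏ m ψ-factor) *ᵖ (f *ᵖ ∏ m ψ-factor) *ᵖ ψ-factor 0
      ≈⟨ square-step f (∏ m ψ-factor) (ψ-factor 0) ⟩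
    f *ᵖ (f *ᵖ (∏ m ψ-factor *ᵖ ∏ m ψ-factor *ᵖ ψ-factor 0))
      ≈⟨ *-congˡ {f} (*-congˡ {f} (∏-square m)) ⟩
    f *ᵖ (f *ᵖ f)
      ≈⟨ ψ-factor-cube m ⟩
    ψ-factor (suc m) ∎
    where f = ψ-factor m

  -- The coefficient at `n` sees `Ψ` only up to degree `n`, where it agrees with `∏ n ψ-factor`; and
  -- `ψ-factor n` agrees with 1 up to degree `n`.
  Ψ-square : Ψ *ᵖ Ψ *ᵖ (1ᵖ +ᵖ zᵖ^ 1) ≈ 1ᵖ
  Ψ-square = coefficientwise λ n → ≡ᵐ-trans
    (≡ᵐ-reflexive (*ᵖ-cong-upto {b = 1ᵖ +ᵖ zᵖ^ 1} {b′ = ψ-factor 0} n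
      (λ k k≤n → *ᵖ-cong-upto k (limit k≤n) (limit k≤n))
      (λ _ _ → refl)))
    (≡ᵐ-trans (coefficient (∏-square n) n) (≡ᵐ-reflexive (Ψ-factor n n ℕₚ.≤-refl)))
    where
    limit : ∀ {k n} → k ≤ n → ∀ i → i ≤ k → Ψ i ≡ ∏ n ψ-factor i
    limit k≤n i i≤k = sym (Ψ-limit _ i (ℕₚ.≤-trans i≤k k≤n))

  Ψ⟨-z⟩-square : (Ψ ⟨-z⟩) *ᵖ (Ψ ⟨-z⟩) *ᵖ (const 1ℤ -ᵖ zᵖ^ 1) ≈ const 1ℤ
  Ψ⟨-z⟩-square = begin
    (Ψ ⟨-z⟩) *ᵖ (Ψ ⟨-z⟩) *ᵖ (const 1ℤ -ᵖ zᵖ^ 1)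
      ≈⟨ *-cong (≗⇒≈ (⟨-z⟩-* Ψ Ψ)) (≗⇒≈ 1+z) ⟨
    ((Ψ *ᵖ Ψ) ⟨-z⟩) *ᵖ ((1ᵖ +ᵖ zᵖ^ 1) ⟨-z⟩)
      ≈⟨ ≗⇒≈ (⟨-z⟩-* (Ψ *ᵖ Ψ) (1ᵖ +ᵖ zᵖ^ 1)) ⟨
    (Ψ *ᵖ Ψ *ᵖ (1ᵖ +ᵖ zᵖ^ 1)) ⟨-z⟩
      ≈⟨ coefficientwise (λ n → *-≡ᵐ (≡ᵐ-reflexive { -1ℤ ℤ.^ n} refl) (coefficient Ψ-square n)) ⟩
    1ᵖ ⟨-z⟩
      ≈⟨ ≗⇒≈ 1⟨-z⟩ ⟩
    const 1ℤ ∎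
    where
    1⟨-z⟩ : 1ᵖ ⟨-z⟩ ≗ const 1ℤ
    1⟨-z⟩ zero    = refl
    1⟨-z⟩ (suc n) = ℤₚ.*-zeroʳ (-1ℤ ℤ.^ suc n)

    1+z : (1ᵖ +ᵖ zᵖ^ 1) ⟨-z⟩ ≗ const 1ℤ -ᵖ zᵖ^ 1
    1+z zero          = refl
    1+z (suc zero)    = refl
    1+z (suc (suc n)) = ℤₚ.*-zeroʳ (-1ℤ ℤ.^ suc (suc n))

-- Binomial coefficient identities

module _ where
  open import Data.Nat.Base using (_*_; _+_)
  open ≡-Reasoning
  open ℕSolver.+-*-Solver

  -- The absorption identity: Pascal's rule splits the left-hand side, induction on `n` treats the
  -- parts, and Pascal's rule recombines them.
  [k+1]*[n+1]C[k+1] : ∀ n k → suc k * (suc n C suc k) ≡ suc n * (n C k)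
  [k+1]*[n+1]C[k+1] zero    zero    = refl
  [k+1]*[n+1]C[k+1] zero    (suc k) = ℕₚ.*-zeroʳ (suc (suc k))
  [k+1]*[n+1]C[k+1] (suc n) zero    = begin
    1 * (suc (suc n) C 1)   ≡⟨ ℕₚ.*-identityˡ _ ⟩
    suc (suc n) C 1         ≡⟨ nC1≡n (suc (suc n)) ⟩
    suc (suc n)             ≡⟨ ℕₚ.*-identityʳ _ ⟨
    suc (suc n) * 1         ∎
  [k+1]*[n+1]C[k+1] (suc n) (suc k) = begin
    suc (suc k) * (suc (suc n) C suc (suc k))
      ≡⟨ cong (suc (suc k) *_) (nCk+nC[k+1]≡[n+1]C[k+1] (suc n) (suc k)) ⟨
    suc (suc k) * (a + b)
      ≡⟨ solve 3 (λ k a b → (con 2 :+ k) :* (a :+ b)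
                         := a :+ ((con 1 :+ k) :* a :+ (con 2 :+ k) :* b)) refl k a b ⟩
    a + (suc k * a + suc (suc k) * b)
      ≡⟨ cong (λ t → a + t) (cong₂ _+_ ([k+1]*[n+1]C[k+1] n k) ([k+1]*[n+1]C[k+1] n (suc k))) ⟩
    a + (suc n * (n C k) + suc n * (n C suc k))
      ≡⟨ cong (λ t → a + t) (ℕₚ.*-distribˡ-+ (suc n) (n C k) (n C suc k)) ⟨
    a + suc n * (n C k + n C suc k)
      ≡⟨ cong (λ t → a + suc n * t) (nCk+nC[k+1]≡[n+1]C[k+1] n k) ⟩
    suc (suc n) * a ∎
    where
    a = suc n C suc k
    b = suc n C suc (suc k)

  [k+l]Ck≡[k+l]Cl : ∀ k l → (k + l) C k ≡ (k + l) C l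
  [k+l]Ck≡[k+l]Cl k l = trans (nCk≡nC[n∸k] (ℕₚ.m≤m+n k l)) (cong ((k + l) C_) (ℕₚ.m+n∸m≡n k l))

  -- Pascal's rule gives the two middle entries of row 2n + 1, which are equal by symmetry.
  2[n+1]C[n+1] : ∀ n → (2 * suc n) C suc n ≡ 2 * (suc (2 * n) C suc n)
  2[n+1]C[n+1] n = begin
    (2 * suc n) C suc n
      ≡⟨ cong (_C suc n) (ℕₚ.*-suc 2 n) ⟩
    suc (suc (2 * n)) C suc n
      ≡⟨ nCk+nC[k+1]≡[n+1]C[k+1] (suc (2 * n)) n ⟨
    suc (2 * n) C n + suc (2 * n) C suc n
      ≡⟨ cong (_+ suc (2 * n) C suc n) (subst (λ m → m C n ≡ m C suc n)
           (solve 1 (λ n → n :+ (con 1 :+ n) := con 1 :+ con 2 :* n) refl n)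
           ([k+l]Ck≡[k+l]Cl n (suc n))) ⟩
    suc (2 * n) C suc n + suc (2 * n) C suc n
      ≡⟨ solve 1 (λ a → a :+ a := con 2 :* a) refl (suc (2 * n) C suc n) ⟩
    2 * (suc (2 * n) C suc n) ∎

  -- Absorption applied to the halved central coefficient. This recurrence is the source of the
  -- differential equation `θ-central`.
  [n+1]*2[n+1]C[n+1] : ∀ n → suc n * ((2 * suc n) C suc n) ≡ (4 * n + 2) * ((2 * n) C n)
  [n+1]*2[n+1]C[n+1] n = begin
    suc n * ((2 * suc n) C suc n)
      ≡⟨ cong (suc n *_) (2[n+1]C[n+1] n) ⟩
    suc n * (2 * (suc (2 * n) C suc n))
      ≡⟨ solve 2 (λ n a → n :* (con 2 :* a) := con 2 :* (n :* a)) refl (suc n) (suc (2 * n) C suc n) ⟩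
    2 * (suc n * (suc (2 * n) C suc n))
      ≡⟨ cong (2 *_) ([k+1]*[n+1]C[k+1] (2 * n) n) ⟩
    2 * (suc (2 * n) * ((2 * n) C n))
      ≡⟨ solve 2 (λ n a → con 2 :* ((con 1 :+ con 2 :* n) :* a) := (con 4 :* n :+ con 2) :* a)
           refl n ((2 * n) C n) ⟩
    (4 * n + 2) * ((2 * n) C n) ∎

  -- After halving, Pascal's rule leads to row 2n + 2, where symmetry moves the index n + 2 to n.
  -- This is the relation between S and L, coefficient by coefficient.
  2[n+2]C[n+2] : ∀ n → (2 * suc (suc n)) C suc (suc n)
                     ≡ 2 * ((2 * suc n) C suc n + (2 * n + 2) C n)
  2[n+2]C[n+2] n = begin
    (2 * suc (suc n)) C suc (suc n)
      ≡⟨ 2[n+1]C[n+1] (suc n) ⟩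
    2 * (suc (2 * suc n) C suc (suc n))
      ≡⟨ cong (2 *_) (nCk+nC[k+1]≡[n+1]C[k+1] (2 * suc n) (suc n)) ⟨
    2 * ((2 * suc n) C suc n + (2 * suc n) C suc (suc n))
      ≡⟨ cong (λ t → 2 * ((2 * suc n) C suc n + t)) (begin
           (2 * suc n) C suc (suc n)
             ≡⟨ cong (_C suc (suc n)) (solve 1 (λ n → con 2 :* (con 1 :+ n) := n :+ (con 2 :+ n)) refl n) ⟩
           (n + suc (suc n)) C suc (suc n)
             ≡⟨ [k+l]Ck≡[k+l]Cl n (suc (suc n)) ⟨
           (n + suc (suc n)) C n
             ≡⟨ cong (_C n) (solve 1 (λ n → n :+ (con 2 :+ n) := con 2 :* n :+ con 2) refl n) ⟩
           (2 * n + 2) C n ∎) ⟩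
    2 * ((2 * suc n) C suc n + (2 * n + 2) C n) ∎

-- The generating functions S and L

central : PowerSeries
central n = + ((2 *ℕ n) C n)

shifted : PowerSeries
shifted n = + ((2 *ℕ n +ℕ 2) C n)

-- The relation 1 + 2z²L = (1 - 2z) S, arranged so that each coefficient is compared after removing
-- one factor z.
central-shifted : central ≗ const 1ℤ +ᵖ zᵖ^ 1 *ᵖ (const (+ 2) *ᵖ (central +ᵖ zᵖ^ 1 *ᵖ shifted))
central-shifted zero    = refl
central-shifted (suc n) = sym (trans (ℤₚ.+-identityˡ _)
  (trans (zᵖ-*-suc (const (+ 2) *ᵖ a) n) (trans (const-* (+ 2) a n) (step n))))
  where
  a = central +ᵖ zᵖ^ 1 *ᵖ shifted

  step : ∀ n → + 2 ℤ.* a n ≡ central (suc n)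
  -- zL has no constant term, so this case is separate: it says that S has coefficient 2 at z.
  step zero    = refl
  step (suc n) = begin
    + 2 ℤ.* (central (suc n) ℤ.+ (zᵖ^ 1 *ᵖ shifted) (suc n))
      ≡⟨ cong (λ t → + 2 ℤ.* (central (suc n) ℤ.+ t)) (zᵖ-*-suc shifted n) ⟩
    + 2 ℤ.* (central (suc n) ℤ.+ shifted n)
      ≡⟨ ℤₚ.pos-* 2 ((2 *ℕ suc n) C suc n +ℕ (2 *ℕ n +ℕ 2) C n) ⟨
    + (2 *ℕ ((2 *ℕ suc n) C suc n +ℕ (2 *ℕ n +ℕ 2) C n))
      ≡⟨ cong +_ (2[n+2]C[n+2] n) ⟨
    central (suc (suc n)) ∎
    where open ≡-Reasoning

-- The differential equation (1 - 4z) θS = 2zS, arranged so that its coefficient at `suc n` is the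
-- recurrence `[n+1]*2[n+1]C[n+1]`.
θ-central : θ central ≗ zᵖ^ 1 *ᵖ (const (+ 4) *ᵖ θ central +ᵖ const (+ 2) *ᵖ central)
θ-central zero    = refl
θ-central (suc n) = sym (begin
  (zᵖ^ 1 *ᵖ (const (+ 4) *ᵖ θ central +ᵖ const (+ 2) *ᵖ central)) (suc n)
    ≡⟨ zᵖ-*-suc (const (+ 4) *ᵖ θ central +ᵖ const (+ 2) *ᵖ central) n ⟩
  (const (+ 4) *ᵖ θ central) n ℤ.+ (const (+ 2) *ᵖ central) n
    ≡⟨ cong₂ ℤ._+_ (const-* (+ 4) (θ central) n) (const-* (+ 2) central n) ⟩
  + 4 ℤ.* (+ n ℤ.* central n) ℤ.+ + 2 ℤ.* central n
    ≡⟨ solve 2 (λ n c → con (+ 4) :* (n :* c) :+ con (+ 2) :* c := (con (+ 4) :* n :+ con (+ 2)) :* c)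
         refl (+ n) (central n) ⟩
  (+ 4 ℤ.* + n ℤ.+ + 2) ℤ.* central n
    ≡⟨ cong (λ t → (t ℤ.+ + 2) ℤ.* central n) (ℤₚ.pos-* 4 n) ⟨
  + (4 *ℕ n +ℕ 2) ℤ.* central n
    ≡⟨ ℤₚ.pos-* (4 *ℕ n +ℕ 2) ((2 *ℕ n) C n) ⟨
  + ((4 *ℕ n +ℕ 2) *ℕ ((2 *ℕ n) C n))
    ≡⟨ cong +_ ([n+1]*2[n+1]C[n+1] n) ⟨
  + (suc n *ℕ ((2 *ℕ suc n) C suc n))
    ≡⟨ ℤₚ.pos-* (suc n) ((2 *ℕ suc n) C suc n) ⟩
  θ central (suc n) ∎)
  where
  open ≡-Reasoning
  open ℤSolver.+-*-Solver

module Derivative (R : CommutativeRing 0ℓ 0ℓ)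
  (ι : IntegerConstants R) (ι-cong : RespectsModulo 0ℤ R ι) where
  open CommutativeRing R hiding (zero)
  open ModularSolver 0ℤ R ι ι-cong
  open _-Raw-AlmostCommutative⟶_ ι using () renaming (⟦_⟧ to infix 9 #_)
  open import Relation.Binary.Reasoning.Setoid setoid

  -- With `s′` read as `θ s`, the left-hand side is θ of s² (1 - 4z) by the Leibniz rule. It equals
  -- 2s times the defect of the differential equation.
  derivative-vanishes : ∀ z s s′ → s′ ≈ z * (# (+ 4) * s′ + # (+ 2) * s) →
    (s′ * s + s * s′) * (# (+ 1) - # (+ 4) * z) + s * s * - (# (+ 4) * z) ≈ 0#
  derivative-vanishes z s s′ eq = begin
    (s′ * s + s * s′) * (# (+ 1) - # (+ 4) * z) + s * s * - (# (+ 4) * z)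
      ≈⟨ solve 3 (λ z s s′ →
           (s′ :* s :+ s :* s′) :* (con (+ 1) :- con (+ 4) :* z) :+ s :* s :* :- (con (+ 4) :* z)
             := con (+ 2) :* s :* (s′ :- z :* (con (+ 4) :* s′ :+ con (+ 2) :* s)))
           (CommutativeRing.refl R) z s s′ ⟩
    # (+ 2) * s * (s′ - z * (# (+ 4) * s′ + # (+ 2) * s))
      ≈⟨ *-congˡ (+-congʳ eq) ⟩
    # (+ 2) * s * (z * (# (+ 4) * s′ + # (+ 2) * s) - z * (# (+ 4) * s′ + # (+ 2) * s))
      ≈⟨ *-congˡ (-‿inverseʳ _) ⟩
    # (+ 2) * s * 0#
      ≈⟨ zeroʳ _ ⟩
    0# ∎

-- Over ℤ the positive factor `suc n` can be cancelled.
θ≗0⇒constant : ∀ a → θ a ≗ 0ᵖ → a ≗ const (a 0)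
θ≗0⇒constant a θa≗0 zero    = sym (ℤₚ.*-identityʳ (a 0))
θ≗0⇒constant a θa≗0 (suc n) = trans
  (ℤₚ.*-cancelˡ-≡ (+ suc n) (a (suc n)) 0ℤ (trans (θa≗0 (suc n)) (sym (ℤₚ.*-zeroʳ (+ suc n)))))
  (sym (ℤₚ.*-zeroʳ (a 0)))

1-4z : PowerSeries
1-4z = const (+ 1) -ᵖ const (+ 4) *ᵖ zᵖ^ 1

θ-1-4z : θ 1-4z ≗ -ᵖ (const (+ 4) *ᵖ zᵖ^ 1)
θ-1-4z zero          = refl
θ-1-4z (suc zero)    = refl
θ-1-4z (suc (suc n)) = trans
  (cong (λ t → + suc (suc n) ℤ.* (0ℤ ℤ.- t)) (const-* (+ 4) (zᵖ^ 1) (suc (suc n))))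
  (trans (ℤₚ.*-zeroʳ (+ suc (suc n))) (cong ℤ.-_ (sym (const-* (+ 4) (zᵖ^ 1) (suc (suc n))))))

-- The derivative is computed modulo 0, that is exactly, and the constant coefficient 1 is found by
-- evaluation.
central-square : central *ᵖ central *ᵖ 1-4z ≗ const (+ 1)
central-square = θ≗0⇒constant (central *ᵖ central *ᵖ 1-4z) λ n → begin
  θ (central *ᵖ central *ᵖ 1-4z) n
    ≡⟨ θ-* (central *ᵖ central) 1-4z n ⟩
  (θ (central *ᵖ central) *ᵖ 1-4z) n ℤ.+ (central *ᵖ central *ᵖ θ 1-4z) n
    ≡⟨ cong₂ ℤ._+_ (*ᵖ-congʳ 1-4z (θ-* central central) n) (*ᵖ-congˡ (central *ᵖ central) θ-1-4z n) ⟩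
  _
    ≡⟨ ≈0⇒≗ (derivative-vanishes (zᵖ^ 1) central (θ central) (≗⇒≈ θ-central)) n ⟩
  0ℤ ∎
  where
  open ≡-Reasoning
  open Modulo 0ℤ
  open Derivative ring constants const-cong

  ≈0⇒≗ : ∀ {a b} → a ≈ b → a ≗ b
  ≈0⇒≗ a≈b n = ℤₚ.i-j≡0⇒i≡j _ _ (0∣⇒≡0 (difference (coefficient a≈b n)))

-- Laurent expressions and their numerators

module LaurentExpressions (m : ℤ) (R : CommutativeRing 0ℓ 0ℓ)
  (ι : IntegerConstants R) (ι-cong : RespectsModulo m R ι) where
  open ModularSolver m R ι ι-cong

  infixl 6 _⊕_ _⊖_
  infixl 7 _⊗_ _⊘_
  infix  8 ⊝_
  infixr 8 _⊛_

  -- Variable 0 is z.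
  data Expr (n : ℕ) : Set where
    poly        : Polynomial (suc n) → Expr n
    _⊕_ _⊖_ _⊗_ : Expr n → Expr n → Expr n
    ⊝_          : Expr n → Expr n
    _⊘_ _⊛_     : Expr n → ℕ → Expr n

  order : ∀ {n} → Expr n → ℕ
  order (poly p) = 0
  order (e ⊕ f)  = order e +ℕ order f
  order (e ⊖ f)  = order e +ℕ order f
  order (e ⊗ f)  = order e +ℕ order f
  order (⊝ e)    = order e
  order (e ⊘ k)  = order e +ℕ k
  order (e ⊛ k)  = k *ℕ order e

  -- Follows the representation of Laurent series, in which pole orders add even in sums: each
  -- summand is multiplied by the power of z belonging to the other.
  numerator : ∀ {n} → Expr n → Polynomial (suc n)
  numerator (poly p) = p
  numerator (e ⊕ f)  = var zero :^ order f :* numerator e :+ var zero :^ order e :* numerator f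
  numerator (e ⊖ f)  = var zero :^ order f :* numerator e :- var zero :^ order e :* numerator f
  numerator (e ⊗ f)  = numerator e :* numerator f
  numerator (⊝ e)    = :- numerator e
  numerator (e ⊘ k)  = numerator e
  numerator (e ⊛ k)  = numerator e :^ k

-- Elimination of Ψ(-z) modulo 27

module Elimination (R : CommutativeRing 0ℓ 0ℓ)
  (ι : IntegerConstants R) (ι-cong : RespectsModulo (+ 27) R ι) where
  open CommutativeRing R
    using (Carrier; _≈_; _+_; _*_; _-_; 0#; setoid; +-cong; +-congʳ; *-congʳ; -‿cong; -‿inverseʳ)
    renaming (refl to ≈-refl)
  open import Algebra.Properties.Semiring.Exp (CommutativeRing.semiring R) using (_^_; ^-congˡ)
  open ModularSolver (+ 27) R ι ι-cong
  open _-Raw-AlmostCommutative⟶_ ι using () renaming (⟦_⟧ to infix 9 #_)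
  open import Relation.Binary.Reasoning.Setoid setoid

  -- z² times the right-hand side of the theorem.
  rhs : ∀ {n} (z v p : Polynomial n) → Polynomial n
  rhs z v p =
    con (+ 13)
    :+ con (+ 3) :* (:- (z :+ con (+ 1)) :+ con (+ 3) :* ((con (+ 1) :- z :- z :^ 2) :* v)) :* p
    :+ (con (+ 4) :* z :^ 2 :+ con (+ 6) :* z :- con (+ 4)) :* p :^ 3
    :+ con (+ 3) :* (con (+ 4) :* z :^ 3 :+ con (+ 2) :* z :^ 2 :- z :- con (+ 5)) :* p :^ 5

  -- (1 + 2 rhs)² (1 - 4z) (1 - z)⁵ modulo 27, in terms of t = (1 - z) v and e = p² (1 - z).
  form : ∀ {n} (z t e : Polynomial n) → Polynomial n
  form z t e = e :* g :^ 2 :* (con (+ 1) :- con (+ 4) :* z)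
    where
    u = con (+ 1) :- z
    -- As 1 + 2 · 13 = 27 vanishes, 1 + 2 `rhs` is p times a polynomial in p², z and v; `g` is that
    -- polynomial times `u` squared. The fifth factor `u` turns the p² left outside into `e`.
    g = con (+ 18) :* (con (+ 1) :- z :- z :^ 2) :* u :* t
        :- con (+ 6) :* (z :+ con (+ 1)) :* u :^ 2
        :+ (con (+ 8) :* z :^ 2 :+ con (+ 12) :* z :- con (+ 8)) :* u :* e
        :+ con (+ 6) :* (con (+ 4) :* z :^ 3 :+ con (+ 2) :* z :^ 2 :- z :- con (+ 5)) :* e :^ 2

  module _ (z v p l : Carrier) where

    -- `v`, `p` and `l` stand for 1/(1 - z), Ψ(-z) and L.
    r x y u w cofactor : Carrier
    r = ⟦ rhs (var zero) (var (suc zero)) (var (suc (suc zero))) ⟧ (z ∷ v ∷ p ∷ [])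
    x = # (+ 1) + # (+ 2) * (z ^ 2 * l)
    y = # (+ 1) + # (+ 2) * r
    u = # (+ 1) - z
    w = # (+ 1) - # (+ 4) * z
    -- `x - y` is twice `z ^ 2 * l - r`, so `# (+ 2) * (x + y)` produces a difference of squares;
    -- `w` and `u ^ 5` make both squares polynomials in z modulo 27.
    cofactor = # (+ 2) * (x + y) * w * u ^ 5

    module _ (f s : Carrier)
      (v-inverse : (# (+ 1) - z) * v ≈ # (+ 1))
      (p-square  : p * p * (# (+ 1) - z) ≈ # (+ 1) + # (+ 3) * f)
      (s-square  : s * s * (# (+ 1) - # (+ 4) * z) ≈ # (+ 1))
      (s-linear  : s ≈ # (+ 1) + z * (# (+ 2) * (s + z * l)))
      where

      x-linear : x ≈ (# (+ 1) - # (+ 2) * z) * s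
      x-linear = begin
        # (+ 1) + # (+ 2) * (z ^ 2 * l)
          ≈⟨ solve 3 (λ z s l → con (+ 1) :+ con (+ 2) :* (z :^ 2 :* l)
               := con (+ 1) :+ z :* (con (+ 2) :* (s :+ z :* l)) :- con (+ 2) :* z :* s) ≈-refl z s l ⟩
        # (+ 1) + z * (# (+ 2) * (s + z * l)) - # (+ 2) * z * s
          ≈⟨ +-congʳ s-linear ⟨
        s - # (+ 2) * z * s
          ≈⟨ x-y≈#0⇒x≈y (solve 2 (λ z s →
               s :- con (+ 2) :* z :* s :- (con (+ 1) :- con (+ 2) :* z) :* s := con 0ℤ) ≈-refl z s) ⟩
        (# (+ 1) - # (+ 2) * z) * s ∎

      x-square : x ^ 2 * w * u ^ 5 ≈ (# (+ 1) - # (+ 2) * z) ^ 2 * u ^ 5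
      x-square = begin
        x ^ 2 * w * u ^ 5
          ≈⟨ *-congʳ (*-congʳ (^-congˡ 2 x-linear)) ⟩
        ((# (+ 1) - # (+ 2) * z) * s) ^ 2 * w * u ^ 5
          ≈⟨ solve 4 (λ d s w u → (d :* s) :^ 2 :* w :* u :^ 5 := s :* s :* w :* (d :^ 2 :* u :^ 5))
               ≈-refl (# (+ 1) - # (+ 2) * z) s w u ⟩
        s * s * w * ((# (+ 1) - # (+ 2) * z) ^ 2 * u ^ 5)
          ≈⟨ *-congʳ s-square ⟩
        # (+ 1) * ((# (+ 1) - # (+ 2) * z) ^ 2 * u ^ 5)
          ≈⟨ solve 1 (λ a → con (+ 1) :* a := a) ≈-refl _ ⟩
        (# (+ 1) - # (+ 2) * z) ^ 2 * u ^ 5 ∎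

      y-square : y ^ 2 * w * u ^ 5 ≈ (# (+ 1) - # (+ 2) * z) ^ 2 * u ^ 5
      y-square = begin
        y ^ 2 * w * u ^ 5
          ≈⟨ x-y≈#0⇒x≈y (solve 3 (λ z v p →
               (con (+ 1) :+ con (+ 2) :* rhs z v p) :^ 2 :* (con (+ 1) :- con (+ 4) :* z)
                 :* (con (+ 1) :- z) :^ 5
               :- form z ((con (+ 1) :- z) :* v) (p :* p :* (con (+ 1) :- z))
               := con 0ℤ) ≈-refl z v p) ⟩
        ⟦ form′ ⟧ (z ∷ u * v ∷ p * p * u ∷ [])
          -- The relations (1 - z) v = 1 and p² (1 - z) = 1 + 3F eliminate `v` and `p`.
          ≈⟨ ⟦⟧-cong form′ (≈-refl ∷ v-inverse ∷ p-square ∷ []) ⟩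
        ⟦ form′ ⟧ (z ∷ # (+ 1) ∷ # (+ 1) + # (+ 3) * f ∷ [])
          -- Every coefficient of this difference, a polynomial in `z` and `f`, is divisible by 27;
          -- here F disappears.
          ≈⟨ x-y≈#0⇒x≈y (solve 2 (λ z f →
               form z (con (+ 1)) (con (+ 1) :+ con (+ 3) :* f)
               :- (con (+ 1) :- con (+ 2) :* z) :^ 2 :* (con (+ 1) :- z) :^ 5
               := con 0ℤ) ≈-refl z f) ⟩
        (# (+ 1) - # (+ 2) * z) ^ 2 * u ^ 5 ∎
        where form′ = form (var zero) (var (suc zero)) (var (suc (suc zero)))

      difference*cofactor : (z ^ 2 * l - r) * cofactor ≈ 0#
      difference*cofactor = begin
        (z ^ 2 * l - r) * cofactor
          ≈⟨ solve 4 (λ a r w u →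
               (a :- r) :* (con (+ 2) :* (con (+ 1) :+ con (+ 2) :* a :+ (con (+ 1) :+ con (+ 2) :* r))
                 :* w :* u :^ 5)
               := (con (+ 1) :+ con (+ 2) :* a) :^ 2 :* w :* u :^ 5
               :- (con (+ 1) :+ con (+ 2) :* r) :^ 2 :* w :* u :^ 5) ≈-refl (z ^ 2 * l) r w u ⟩
        x ^ 2 * w * u ^ 5 - y ^ 2 * w * u ^ 5
          ≈⟨ +-cong x-square (-‿cong y-square) ⟩
        _ - _
          ≈⟨ -‿inverseʳ _ ⟩
        0# ∎

  open LaurentExpressions (+ 27) R ι ι-cong

  -- Repeats the theorem operation by operation, so that its interpretation is the difference of the
  -- two sides by computation.
  sides : Expr 3
  sides = l ⊖ ( ♯ 13 ⊘ 2
              ⊕ ♯ 3 ⊗ (⊝ (z ⊕ ♯ 1) ⊘ 2 ⊕ ♯ 3 ⊗ ((♯ 1 ⊖ z ⊖ z ⊛ 2) ⊗ v ⊘ 2)) ⊗ p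
              ⊕ (♯ 4 ⊕ ♯ 6 ⊘ 1 ⊖ ♯ 4 ⊘ 2) ⊗ p ⊛ 3
              ⊕ ♯ 3 ⊗ (♯ 4 ⊗ z ⊕ ♯ 2 ⊖ ♯ 1 ⊘ 1 ⊖ ♯ 5 ⊘ 2) ⊗ p ⊛ 5)
    where
    infix 9 ♯_
    ♯_ : ℕ → Expr 3
    ♯ c = poly (con (+ c))
    z v p l : Expr 3
    z = poly (var zero)
    v = poly (var (suc zero))
    p = poly (var (suc (suc zero)))
    l = poly (var (suc (suc (suc zero))))

  -- The pole orders of the four summands on the right add up to 2 + 4 + 3 + 3 = 12, of which `rhs`
  -- clears only 2; this leaves `z ^ 10`.
  numerator-sides : ∀ z v p l →
    ⟦ numerator sides ⟧ (z ∷ v ∷ p ∷ l ∷ []) ≈ z ^ 10 * (z ^ 2 * l - r z v p l)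
  numerator-sides z v p l = x-y≈#0⇒x≈y (prove (z ∷ v ∷ p ∷ l ∷ [])
    (numerator sides :- z′ :^ 10 :* (z′ :^ 2 :* var (suc (suc (suc zero)))
      :- rhs z′ (var (suc zero)) (var (suc (suc zero)))))
    (con 0ℤ) ≈-refl)
    where z′ = var zero

-- Divisibility of all coefficients of a product

*ᵖ-∣ : ∀ {m} a b n → (∀ k → k ≤ n → m ∣ b k) → m ∣ (a *ᵖ b) n
*ᵖ-∣ a b zero    m∣b = ∣m∣n⇒∣m+n (∣n⇒∣m*n (a 0) (m∣b 0 z≤n)) (divides 0ℤ refl)
*ᵖ-∣ a b (suc n) m∣b = ∣m∣n⇒∣m+n (∣n⇒∣m*n (a 0) (m∣b (suc n) ℕₚ.≤-refl))
  (*ᵖ-∣ (tail a) b n (λ k k≤n → m∣b k (ℕₚ.m≤n⇒m≤1+n k≤n)))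

-- In the coefficient at `n`, the terms other than `a 0 ℤ.* b n` contain lower coefficients of `b`,
-- divisible by induction; coprimality then removes `a 0`.
*ᵖ-cancel-∣ : ∀ {m} a b → Coprime m (a 0) → (∀ n → m ∣ (a *ᵖ b) n) → ∀ n → m ∣ b n
*ᵖ-cancel-∣ {m} a b coprime m∣ab n = upto n n ℕₚ.≤-refl
  where
  cancel : ∀ {x} → m ∣ a 0 ℤ.* x → m ∣ x
  cancel {x} m∣a₀x = ∣ᵤ⇒∣ (coprime-divisor m (a 0) x coprime (∣⇒∣ᵤ m∣a₀x))

  upto : ∀ n k → k ≤ n → m ∣ b k
  upto zero    zero    _   = cancel (∣m+n∣n⇒∣m (m∣ab 0) (divides 0ℤ refl))
  upto (suc n) k k≤1+n with ℕₚ.m≤n⇒m<n∨m≡n k≤1+n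
  ... | inj₁ (s≤s k≤n) = upto n k k≤n
  ... | inj₂ refl      = cancel (∣m+n∣n⇒∣m (m∣ab (suc n)) (*ᵖ-∣ (tail a) b n (upto n)))

-- Interpretation of Laurent expressions as Laurent series

module LaurentPolynomials (m : ℤ) where
  open Modulo m
  open CommutativeRing ring using (*-cong; +-cong; -‿cong; *-identityˡ; *-assoc; *-congˡ)
    renaming (refl to ≈-refl; sym to ≈-sym; trans to ≈-trans)
  open ModularSolver m ring constants const-cong
  open LaurentExpressions m ring constants const-cong public
  open _-Raw-AlmostCommutative⟶_ constants using (1-homo)
  open import Algebra.Properties.Semiring.Exp (CommutativeRing.semiring ring) using (_^_)
  open Defs using (_+_; _-_; _*_; -_; _/z^_) renaming (_^_ to _^ˡ_)

  shift≗ : ∀ k a → shift k a ≈ (zᵖ^ 1) ^ k *ᵖ a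
  shift≗ zero    a = ≈-sym (*-identityˡ a)
  shift≗ (suc k) a = ≈-trans (≗⇒≈ z*shift)
    (≈-trans (*-congˡ {zᵖ^ 1} (shift≗ k a)) (≈-sym (*-assoc (zᵖ^ 1) ((zᵖ^ 1) ^ k) a)))
    where
    z*shift : shift (suc k) a ≗ zᵖ^ 1 *ᵖ shift k a
    z*shift zero    = refl
    z*shift (suc n) = sym (zᵖ-*-suc (shift k a) n)

  shift-cong : ∀ {j k a b} → j ≡ k → a ≈ b → shift j a ≈ (zᵖ^ 1) ^ k *ᵖ b
  shift-cong {j} {a = a} refl a≈b = ≈-trans (shift≗ j a) (*-congˡ {(zᵖ^ 1) ^ j} a≈b)

  ⟪_⟫ : ∀ {n} → Expr n → Vec PowerSeries n → Laurent
  ⟪ poly p ⟫ ρ = series (⟦ p ⟧ (zᵖ^ 1 ∷ ρ))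
  ⟪ e ⊕ f  ⟫ ρ = ⟪ e ⟫ ρ + ⟪ f ⟫ ρ
  ⟪ e ⊖ f  ⟫ ρ = ⟪ e ⟫ ρ - ⟪ f ⟫ ρ
  ⟪ e ⊗ f  ⟫ ρ = ⟪ e ⟫ ρ * ⟪ f ⟫ ρ
  ⟪ ⊝ e    ⟫ ρ = - ⟪ e ⟫ ρ
  ⟪ e ⊘ k  ⟫ ρ = ⟪ e ⟫ ρ /z^ k
  ⟪ e ⊛ k  ⟫ ρ = ⟪ e ⟫ ρ ^ˡ k

  pole-⟪⟫ : ∀ {n} (e : Expr n) ρ → pole (⟪ e ⟫ ρ) ≡ order e
  pole-⟪⟫ (poly p) ρ = refl
  pole-⟪⟫ (e ⊕ f)  ρ = cong₂ _+ℕ_ (pole-⟪⟫ e ρ) (pole-⟪⟫ f ρ)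
  pole-⟪⟫ (e ⊖ f)  ρ = cong₂ _+ℕ_ (pole-⟪⟫ e ρ) (pole-⟪⟫ f ρ)
  pole-⟪⟫ (e ⊗ f)  ρ = cong₂ _+ℕ_ (pole-⟪⟫ e ρ) (pole-⟪⟫ f ρ)
  pole-⟪⟫ (⊝ e)    ρ = pole-⟪⟫ e ρ
  pole-⟪⟫ (e ⊘ k)  ρ = cong (_+ℕ k) (pole-⟪⟫ e ρ)
  pole-⟪⟫ (e ⊛ k)  ρ = power k
    where
    power : ∀ k → pole (⟪ e ⟫ ρ ^ˡ k) ≡ k *ℕ order e
    power zero    = refl
    power (suc k) = cong₂ _+ℕ_ (pole-⟪⟫ e ρ) (power k)

  -- Reduces a statement on Laurent series to one on polynomials. Shifts in sums become
  -- multiplications by powers of z, with exponents known from `pole-⟪⟫`.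
  coefs-⟪⟫ : ∀ {n} (e : Expr n) ρ → coefs (⟪ e ⟫ ρ) ≈ ⟦ numerator e ⟧ (zᵖ^ 1 ∷ ρ)

  shift-coefs : ∀ {n} (e f : Expr n) ρ → shift (pole (⟪ e ⟫ ρ)) (coefs (⟪ f ⟫ ρ))
                ≈ ⟦ var zero :^ order e :* numerator f ⟧ (zᵖ^ 1 ∷ ρ)
  shift-coefs e f ρ = shift-cong (pole-⟪⟫ e ρ) (coefs-⟪⟫ f ρ)

  coefs-⟪⟫ (poly p) ρ = ≈-refl {⟦ p ⟧ (zᵖ^ 1 ∷ ρ)}
  coefs-⟪⟫ (e ⊕ f)  ρ = +-cong
    {shift (pole (⟪ f ⟫ ρ)) (coefs (⟪ e ⟫ ρ))} {⟦ var zero :^ order f :* numerator e ⟧ (zᵖ^ 1 ∷ ρ)}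
    {shift (pole (⟪ e ⟫ ρ)) (coefs (⟪ f ⟫ ρ))} {⟦ var zero :^ order e :* numerator f ⟧ (zᵖ^ 1 ∷ ρ)}
    (shift-coefs f e ρ) (shift-coefs e f ρ)
  coefs-⟪⟫ (e ⊖ f)  ρ = +-cong
    {shift (pole (⟪ f ⟫ ρ)) (coefs (⟪ e ⟫ ρ))} {⟦ var zero :^ order f :* numerator e ⟧ (zᵖ^ 1 ∷ ρ)}
    { -ᵖ shift (pole (⟪ e ⟫ ρ)) (coefs (⟪ f ⟫ ρ))}
    {⟦ :- (var zero :^ order e :* numerator f) ⟧ (zᵖ^ 1 ∷ ρ)}
    (shift-coefs f e ρ) (-‿cong (shift-coefs e f ρ))
  coefs-⟪⟫ (e ⊗ f)  ρ = *-cong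
    {coefs (⟪ e ⟫ ρ)} {⟦ numerator e ⟧ (zᵖ^ 1 ∷ ρ)}
    {coefs (⟪ f ⟫ ρ)} {⟦ numerator f ⟧ (zᵖ^ 1 ∷ ρ)}
    (coefs-⟪⟫ e ρ) (coefs-⟪⟫ f ρ)
  coefs-⟪⟫ (⊝ e)    ρ = -‿cong {coefs (⟪ e ⟫ ρ)} {⟦ numerator e ⟧ (zᵖ^ 1 ∷ ρ)} (coefs-⟪⟫ e ρ)
  coefs-⟪⟫ (e ⊘ k)  ρ = coefs-⟪⟫ e ρ
  coefs-⟪⟫ (e ⊛ k)  ρ = power k
    where
    power : ∀ k → coefs (⟪ e ⟫ ρ ^ˡ k) ≈ ⟦ numerator e :^ k ⟧ (zᵖ^ 1 ∷ ρ)
    power zero    = 1-homo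
    power (suc k) = *-cong
      {coefs (⟪ e ⟫ ρ)} {⟦ numerator e ⟧ (zᵖ^ 1 ∷ ρ)}
      {coefs (⟪ e ⟫ ρ ^ˡ k)} {⟦ numerator e :^ k ⟧ (zᵖ^ 1 ∷ ρ)}
      (coefs-⟪⟫ e ρ) (power k)

-- Divisibility by 27 of the difference of the two sides

1/[1-z]-coefs-inverse : (const 1ℤ -ᵖ zᵖ^ 1) *ᵖ coefs 1/[1-z] ≗ const 1ℤ
1/[1-z]-coefs-inverse zero          = refl
1/[1-z]-coefs-inverse (suc zero)    = refl
1/[1-z]-coefs-inverse (suc (suc n)) =
  cong (λ t → 1ℤ ℤ.+ (-1ℤ ℤ.+ t)) (*ᵖ-zeroˡ (coefs 1/[1-z]) n)

coeff-∣ : ∀ {m} f → (∀ n → m Unsigned.∣ coefs f n) → ∀ i → m Unsigned.∣ coeff f i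
coeff-∣ f m∣f i with i ℤ.+ + pole f
... | + n        = m∣f n
... | ℤ.-[1+ _ ] = ℕ.divides 0 refl

module _ where
  open Modulo (+ 27)
  open Elimination ring constants const-cong
  open ModularSolver (+ 27) ring constants const-cong
  open LaurentPolynomials (+ 27)
  open CommutativeRing ring using () renaming (trans to ≈-trans)
  open import Algebra.Properties.Semiring.Exp (CommutativeRing.semiring ring) using (_^_)

  scaled-difference : PowerSeries
  scaled-difference = (zᵖ^ 1) ^ 2 *ᵖ shifted -ᵖ right
    where right = ⟦ rhs (var zero) (var (suc zero)) (var (suc (suc zero))) ⟧
                    (zᵖ^ 1 ∷ coefs 1/[1-z] ∷ Ψ ⟨-z⟩ ∷ [])

  27∣scaled-difference : ∀ n → + 27 ∣ scaled-difference n
  27∣scaled-difference = *ᵖ-cancel-∣ cofac scaled-difference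
    -- The constant term of `cofac` is 2 · (1 + 1) = 4, because `rhs` has constant term 13 + 6 - 4 -
    -- 15 = 0.
    (toWitness {a? = coprime? (+ 27) (+ 4)} tt)
    (λ n → ∣-resp-≡ᵐ (≡ᵐ-trans (≡ᵐ-reflexive (*ᵖ-comm cofac scaled-difference n))
                               (coefficient product≈0 n))
                     (divides 0ℤ refl))
    where
    -- The series F with Ψ(-z)² (1 - z) = 1 + 3F.
    q = Modulo.quotientᵖ (+ 3) Ψ⟨-z⟩-square
    cofac = cofactor (zᵖ^ 1) (coefs 1/[1-z]) (Ψ ⟨-z⟩) shifted
    product≈0 = difference*cofactor (zᵖ^ 1) (coefs 1/[1-z]) (Ψ ⟨-z⟩) shifted q central
      (≗⇒≈ 1/[1-z]-coefs-inverse) (≗⇒≈ (Modulo.≈⇒≗ (+ 3) Ψ⟨-z⟩-square))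
      (≗⇒≈ central-square) (≗⇒≈ central-shifted)

  27∣sides : ∀ n → + 27 ∣ coefs (⟪ sides ⟫ (coefs 1/[1-z] ∷ Ψ ⟨-z⟩ ∷ shifted ∷ [])) n
  27∣sides n = ∣-resp-≡ᵐ
    (coefficient (≈-trans
      (coefs-⟪⟫ sides (coefs 1/[1-z] ∷ Ψ ⟨-z⟩ ∷ shifted ∷ []))
      (numerator-sides (zᵖ^ 1) (coefs 1/[1-z]) (Ψ ⟨-z⟩) shifted)) n)
    (*ᵖ-∣ ((zᵖ^ 1) ^ 10) scaled-difference n (λ k _ → 27∣scaled-difference k))

open Defs using (_+_; _-_; _*_; -_; _^_; _/z^_; z; #_)

theorem5p1 : let Ψ[-z] = series (Ψ ⟨-z⟩) in
    series (λ n → + ((2 *ℕ n +ℕ 2) C n))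
    ≈ # (+ 13) /z^ 2
    + # (+ 3) * (- (z + # (+ 1)) /z^ 2 + # (+ 3) * ((# (+ 1) - z - z ^ 2) * 1/[1-z] /z^ 2)) * Ψ[-z]
    + (# (+ 4) + # (+ 6) /z^ 1 - # (+ 4) /z^ 2) * Ψ[-z] ^ 3
    + # (+ 3) * (# (+ 4) * z + # (+ 2) - # (+ 1) /z^ 1 - # (+ 5) /z^ 2) * Ψ[-z] ^ 5
    [mod 27 ]
theorem5p1 = coeff-∣ {+ 27} (⟪ sides ⟫ (coefs 1/[1-z] ∷ Ψ ⟨-z⟩ ∷ shifted ∷ [])) (∣⇒∣ᵤ ∘ 27∣sides)
  where
  open LaurentPolynomials (+ 27) using (⟪_⟫)
  open Modulo (+ 27)
  open Elimination ring constants const-cong using (sides)
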